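{- If $T$ is a tree of order $n$, then $\mathrm{conv}^{\leq 5}(T) \leq \left\lceil \frac{2n-2}{7}\right\rceil$.
   Context: In an oriented graph, the inversion of a vertex set $X$ reverses the orientation of every arc with both endvertices in $X$; a $(\leq p)$-inversion is the inversion of a set of at most $p$ vertices. For a graph $G$, $\mathrm{conv}^{\leq p}(G)$ is the minimum number of $(\leq p)$-inversions transforming an orientation of $G$ into its converse (all arcs reversed); this does not depend on the chosen orientation. -}

module Defs where

open import Data.Nat using (ℕ; zero; suc; _≤_; _+_; _*_; _∸_; _/_)
open import Data.Bool using (Bool; true; false; _∧_; if_then_else_)
open import Data.Fin using (Fin)
open import Data.Fin.Subset using (Subset; ∣_∣)
open import Data.Vec using (lookup)
open import Data.List using (List; []; _∷_; length; foldl; _++_)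
open import Data.Unit using (⊤)
open import Data.Empty using (⊥)
open import Relation.Binary.Construct.Closure.ReflexiveTransitive using (Star)
open import Data.List.Relation.Unary.All using (All)
open import Data.List.Relation.Unary.Unique.Propositional using (Unique)
open import Data.Product using (Σ; _×_; ∃-syntax; _,_)
open import Data.Sum using (_⊎_)
open import Relation.Binary.PropositionalEquality using (_≡_)
open import Relation.Nullary using (¬_)

record Graph (n : ℕ) : Set where
  field
    adj    : Fin n → Fin n → Bool
    sym    : ∀ u v → adj u v ≡ adj v u
    irrefl : ∀ u → adj u u ≡ false
open Graph public

-- A digraph on Fin n: D u v ≡ true means there is an arc u → v.
Digraph : ℕ → Set
Digraph n = Fin n → Fin n → Bool

record IsOrientation {n : ℕ} (G : Graph n) (D : Digraph n) : Set where
  field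
    arc⇒edge  : ∀ u v → D u v ≡ true → adj G u v ≡ true
    edge⇒some : ∀ u v → adj G u v ≡ true → (D u v ≡ true) ⊎ (D v u ≡ true)
    antisym   : ∀ u v → D u v ≡ true → D v u ≡ false

converse : ∀ {n} → Digraph n → Digraph n
converse D u v = D v u

invert : ∀ {n} → Subset n → Digraph n → Digraph n
invert X D u v = if lookup X u ∧ lookup X v then D v u else D u v

invertAll : ∀ {n} → List (Subset n) → Digraph n → Digraph n
invertAll Xs D = foldl (λ E X → invert X E) D Xs

ConvSeq : ∀ {n} → ℕ → Digraph n → List (Subset n) → Set
ConvSeq p D Xs = All (λ X → ∣ X ∣ ≤ p) Xs × (∀ u v → invertAll Xs D u v ≡ converse D u v)

-- conv^{≤p}(G) ≤ k, for the orientation-independent parameter: for every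
-- orientation D of G there are at most k (≤ p)-inversions turning D into
-- its converse.
conv≤ : ∀ {n} → ℕ → Graph n → ℕ → Set
conv≤ p G k = ∀ D → IsOrientation G D → ∃[ Xs ] (length Xs ≤ k × ConvSeq p D Xs)

IsWalk : ∀ {n} → Graph n → List (Fin n) → Set
IsWalk G []           = ⊤
IsWalk G (x ∷ [])     = ⊤
IsWalk G (x ∷ y ∷ xs) = (adj G x y ≡ true) × IsWalk G (y ∷ xs)

IsCycle : ∀ {n} → Graph n → List (Fin n) → Set
IsCycle G []       = ⊥
IsCycle G (x ∷ xs) = 3 ≤ length (x ∷ xs) × Unique (x ∷ xs) × IsWalk G (x ∷ xs ++ x ∷ [])

Connected : ∀ {n} → Graph n → Set
Connected G = ∀ u v → Star (λ x y → adj G x y ≡ true) u v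

Acyclic : ∀ {n} → Graph n → Set
Acyclic G = ∀ xs → ¬ IsCycle G xs

IsTree : ∀ {n} → Graph n → Set
IsTree G = Connected G × Acyclic G

{-# OPTIONS --safe #-}
module Submission where

-- A family of sets reverses a tree iff every edge lies in an odd number of
-- them. By induction on the number m of edges, one either cuts off 4 edges with
-- one set or 7 edges with two sets, leaving a smaller tree; both keep the number
-- of sets at most ⌈2m/7⌉. Reroot the tree at a vertex v all of whose branches
-- but one have at most 4 edges, with at least 4 edges in total. If some of these
-- branches have 4 edges together, they and v form one set. Otherwise there is a
-- branch P with 3 edges and another branch Q with 2 or 3 edges, hung at b.
-- Take the set {v} ∪ P ∪ {b}, which leaves the edges of Q below b. If there is
-- a third branch and it does not yield 4 edges with P or Q, it contains a connected
-- removable piece with 4 − |Q| edges avoiding v; the second set is this piece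
-- together with the vertices of Q.

open import Defs renaming (sym to adj-sym)
open import Algebra.Properties.CommutativeSemigroup using (x∙yz≈y∙xz)
open import Data.Bool using (Bool; true; false; _∧_; _xor_; if_then_else_)
open import Data.Bool.Properties using (∧-comm)
open import Data.Empty using (⊥-elim)
open import Data.Fin using (Fin; zero; suc)
open import Data.Fin.Properties using (injective⇒≤) renaming (_≟_ to _≟ᶠ_)
open import Data.Fin.Subset using (Subset; ∣_∣; ⊥; inside)
open import Data.Fin.Subset.Properties using (∣⊥∣≡0)
open import Data.List as List using (List; []; _∷_; _++_; length; map; tabulate; allFin)
open import Data.List.Properties using (++-identityʳ; map-++; length-tabulate; length-++)
import Data.List.Membership.DecPropositional as DecMembership
open import Data.List.Membership.Propositional using (_∈_; _∉_)
open import Data.List.Membership.Propositional.Properties using (∈-++⁺ˡ; ∈-++⁺ʳ; ∈-++⁻; ∈-allFin; ∈-lookup; ∈-map⁺)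
open import Data.List.Relation.Binary.Permutation.Propositional using (_↭_; refl; prep; swap; trans; ↭-sym; ↭-reflexive; ↭⇒↭ₛ)
open import Data.List.Relation.Binary.Permutation.Propositional.Properties using (shift; shifts; ++⁺ˡ; ++⁺ʳ; ∈-resp-↭)
import Data.List.Relation.Binary.Permutation.Setoid.Properties as Permutationₛ
open import Data.List.Relation.Unary.All as All using (All; []; _∷_)
open import Data.List.Relation.Unary.All.Properties using (¬Any⇒All¬; tabulate⁺)
open import Data.List.Relation.Unary.AllPairs using ([]; _∷_)
open import Data.List.Relation.Unary.Any using (here; there)
open import Data.List.Relation.Unary.Unique.Propositional using (Unique)
open import Data.Nat using (ℕ; zero; suc; _*_; _∸_; _+_; _/_; _≤_; _<_; z≤n; s≤s; s≤s⁻¹)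
open import Data.Nat.DivMod using (m*n/n≡m; /-monoˡ-≤)
open import Data.Nat.Induction using (<-rec)
open import Data.Nat.Properties
open import Data.Nat.Tactic.RingSolver using (solve-∀)
open import Data.Product using (∃-syntax; _×_; _,_; proj₁)
open import Data.Sum as Sum using (_⊎_; inj₁; inj₂)
open import Data.Unit using (tt)
open import Data.Vec using (Vec; []; _∷_; lookup; replicate; _[_]≔_)
open import Data.Vec.Functional using () renaming (_∷_ to _◂_)
open import Data.Vec.Properties using (lookup∘update; lookup∘update′; lookup-replicate)
open import Relation.Binary.Construct.Closure.ReflexiveTransitive using (Star; ε; _◅_; _◅◅_) renaming (map to Star-map; reverse to Star-reverse)
open import Relation.Binary.PropositionalEquality using (_≡_; refl; sym; cong; cong₂; subst; setoid) renaming (trans to ≡-trans)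
open import Relation.Nullary using (yes; no; contradiction)

-- Rooted trees

data Tree (A : Set) : Set where
  node : A → List (Tree A) → Tree A

private variable
  A : Set
  a b : A
  t : Tree A
  ts ss : List (Tree A)
  d k n : ℕ

-- Each vertex of a forest hung at a root has one edge above it, so this is also an edge count.
size : List (Tree A) → ℕ
size []               = 0
size (node _ us ∷ ts) = suc (size us + size ts)

edgeCount : Tree A → ℕ
edgeCount (node _ ts) = size ts

size-∷ : (t : Tree A) (ts : List (Tree A)) → size (t ∷ ts) ≡ suc (edgeCount t + size ts)
size-∷ (node _ _) ts = refl

size-++ : (ss ts : List (Tree A)) → size (ss ++ ts) ≡ size ss + size ts
size-++ []               ts = refl
size-++ (node _ us ∷ ss) ts = cong suc (≡-trans (cong (size us +_) (size-++ ss ts)) (sym (+-assoc (size us) _ _)))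

size-↭ : ts ↭ ss → size ts ≡ size ss
size-↭ refl                               = refl
size-↭ (prep (node _ us) π)               = cong (λ z → suc (size us + z)) (size-↭ π)
size-↭ (swap (node _ us) (node _ vs) π)   rewrite size-↭ π = arith (size us) (size vs) _
  where
  arith : ∀ x y z → 1 + (x + (1 + (y + z))) ≡ 1 + (y + (1 + (x + z)))
  arith = solve-∀
size-↭ (trans π ρ)                        = ≡-trans (size-↭ π) (size-↭ ρ)

-- Colourings

dot : Vec Bool k → Vec Bool k → Bool
dot []       []       = false
dot (x ∷ xs) (y ∷ ys) = (x ∧ y) xor dot xs ys

dot-comm : (p q : Vec Bool k) → dot p q ≡ dot q p
dot-comm []       []       = refl
dot-comm (x ∷ xs) (y ∷ ys) = cong₂ _xor_ (∧-comm x y) (dot-comm xs ys)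

𝟎 : Vec Bool k
𝟎 = replicate _ false

dot-false∷ : ∀ x (p q : Vec Bool k) → dot (x ∷ p) (false ∷ q) ≡ dot p q
dot-false∷ x p q rewrite ∧-comm x false = refl

dot-𝟎 : (p : Vec Bool k) → dot p 𝟎 ≡ false
dot-𝟎 []      = refl
dot-𝟎 (x ∷ p) = ≡-trans (dot-false∷ x p 𝟎) (dot-𝟎 p)

bit : Bool → ℕ
bit x = if x then 1 else 0

-- The colour of a vertex lists which of the k sets contain it, so an edge is
-- reversed iff its end colours have odd inner product; u bounds the set sizes.
mutual
  data Coloring {A : Set} {k : ℕ} (c : Vec Bool k) (u : Fin k → ℕ) : Tree A → Set where
    node : ∀ {a ts w} → ForestColoring c w ts → (∀ i → bit (lookup c i) + w i ≤ u i) → Coloring c u (node a ts)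

  data ForestColoring {A : Set} {k : ℕ} (p : Vec Bool k) (u : Fin k → ℕ) : List (Tree A) → Set where
    []   : ForestColoring p u []
    cons : ∀ {c v w t ts} → dot p c ≡ true → Coloring c v t → ForestColoring p w ts →
           (∀ i → v i + w i ≤ u i) → ForestColoring p u (t ∷ ts)

Solution : ℕ → Tree A → Set
Solution k t = ∃[ c ] Coloring {k = k} c (λ _ → 5) t

private variable
  c p : Vec Bool k
  u v w : Fin k → ℕ

forest-mono : (∀ i → u i ≤ v i) → ForestColoring p u ts → ForestColoring p v ts
forest-mono u≤v []              = []
forest-mono u≤v (cons e f fs q) = cons e f fs (λ i → ≤-trans (q i) (u≤v i))

forest-++ : ForestColoring p u ss → ForestColoring p v ts → (∀ i → u i + v i ≤ w i) → ForestColoring p w (ss ++ ts)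
forest-++ {u = u} [] gs r = forest-mono (λ i → ≤-trans (m≤n+m _ (u i)) (r i)) gs
forest-++ {v = v′} (cons {v = v} {w = w} e f fs q) gs r =
  cons e f (forest-++ fs gs (λ i → ≤-refl))
    (λ i → ≤-trans (≤-reflexive (sym (+-assoc (v i) (w i) (v′ i)))) (≤-trans (+-monoˡ-≤ (v′ i) (q i)) (r i)))

forest-↭ : ts ↭ ss → ForestColoring p u ts → ForestColoring p u ss
forest-↭ refl         fs = fs
forest-↭ (prep _ π)   (cons e f fs q) = cons e f (forest-↭ π fs) q
forest-↭ (swap _ _ π) (cons {v = v} e f (cons {v = v′} {w = w} e′ f′ fs q′) q) =
  cons e′ f′ (cons e f (forest-↭ π fs) (λ i → ≤-refl))
    (λ i → ≤-trans (≤-reflexive (x∙yz≈y∙xz +-commutativeSemigroup (v′ i) (v i) (w i))) (≤-trans (+-monoʳ-≤ (v i) (q′ i)) (q i)))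
forest-↭ (trans π ρ)  fs = forest-↭ ρ (forest-↭ π fs)

coloring-↭ : ts ↭ ss → Coloring c u (node a ts) → Coloring c u (node a ss)
coloring-↭ π (node fs q) = node (forest-↭ π fs) q

-- Colours stay on their vertices. Only the edge between `a` and `b` changes direction, and `dot` is
-- symmetric; the size bounds are the same sums regrouped.
coloring-reroot : Coloring c u (node a (node b ts ∷ ss)) → ∃[ c′ ] Coloring c′ u (node b (node a ss ∷ ts))
coloring-reroot {c = c} {u = u} (node (cons {c = c′} {v = v} {w = w} e (node {w = x} fs q) gs r) s) =
  c′ , node (cons (≡-trans (dot-comm c′ c) e) (node gs (λ i → ≤-refl)) fs (λ i → ≤-refl)) bound
  where
  arith : ∀ β γ w x → β + (γ + w + x) ≡ γ + ((β + x) + w)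
  arith = solve-∀
  bound : ∀ i → bit (lookup c′ i) + (bit (lookup c i) + w i + x i) ≤ u i
  bound i = begin
    bit (lookup c′ i) + (bit (lookup c i) + w i + x i) ≡⟨ arith (bit (lookup c′ i)) (bit (lookup c i)) (w i) (x i) ⟩
    bit (lookup c i) + ((bit (lookup c′ i) + x i) + w i) ≤⟨ +-monoʳ-≤ (bit (lookup c i)) (+-monoˡ-≤ (w i) (q i)) ⟩
    bit (lookup c i) + (v i + w i) ≤⟨ +-monoʳ-≤ (bit (lookup c i)) (r i) ⟩
    bit (lookup c i) + _ ≤⟨ s i ⟩
    u i ∎
    where open ≤-Reasoning

-- Adding one more set

mutual
  coloring-false∷ : Coloring c u t → Coloring (false ∷ c) (0 ◂ u) t
  coloring-false∷ (node fs q) = node (forest-false∷ false fs) λ { zero → z≤n ; (suc i) → q i }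

  -- The parent's new bit `x` is free: every vertex of the forest has new bit `false`, which kills
  -- the product.
  forest-false∷ : ∀ x → ForestColoring p u ts → ForestColoring (x ∷ p) (0 ◂ u) ts
  forest-false∷ x []                          = []
  forest-false∷ {p = p} x (cons {c = c} e f fs q) =
    cons (≡-trans (dot-false∷ x p c) e) (coloring-false∷ f) (forest-false∷ x fs) λ { zero → z≤n ; (suc i) → q i }

-- Every vertex gets the colour `true ∷ 𝟎`, so it lies in the new set only, and the old bits `p` of
-- the parent contribute nothing.
forest-true∷ : (ts : List (Tree A)) → ForestColoring (true ∷ p) (size ts ◂ λ _ → 0) ts
forest-true∷ []                         = []
forest-true∷ {p = p} (node _ us ∷ ts) =
  cons {v = suc (size us) ◂ λ _ → 0} (cong (true xor_) (dot-𝟎 p))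
    (node {w = size us ◂ λ _ → 0} (forest-true∷ us)
      λ { zero → ≤-refl ; (suc i) → ≤-reflexive (cong (λ x → bit x + 0) (lookup-replicate i false)) })
    (forest-true∷ ts)
    λ { zero → ≤-refl {suc (size us + size ts)} ; (suc i) → z≤n }

-- The root joins the new set but no vertex of `ts` does, so the edges of `ts` keep their parity.
coloring-graft : ∀ {x y} (ss : List (Tree A)) → suc (size ss) ≤ x → Coloring c u (node y ts) →
                 Coloring (true ∷ c) (x ◂ u) (node y (ss ++ ts))
coloring-graft ss s≤x (node {w = w} fs q) =
  node {w = size ss ◂ w}
    (forest-++ (forest-true∷ ss) (forest-false∷ true fs)
      λ { zero → ≤-reflexive (+-identityʳ (size ss)) ; (suc i) → ≤-refl })
    λ { zero → s≤x ; (suc i) → q i }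

solution-++ : ∀ {a : A} ss → size ss ≤ 4 → Solution k (node a ts) → Solution (suc k) (node a (ss ++ ts))
solution-++ ss s≤4 (c , f) with coloring-graft ss (s≤s s≤4) f
-- `5 ◂ λ _ → 5` and `λ _ → 5` agree only pointwise, hence the split on the index.
... | node fs q = true ∷ c , node fs λ { zero → q zero ; (suc i) → q (suc i) }

-- The first new set consists of a, the vertices of t, and b. The first set
-- already present avoids a, so the branch of b can be added to it.
solution-two-branches : ∀ {a b : A} {t us} {c : Vec Bool k} {w : Fin k → ℕ} {x} →
  size (t ∷ []) ≡ 3 → x + suc (size us) ≤ 5 →
  ForestColoring (false ∷ c) (x ◂ w) ts → (∀ i → bit (lookup c i) + w i ≤ 5) →
  Solution (2 + k) (node a (t ∷ node b us ∷ ts))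
solution-two-branches {k = k} {t = t} {us = us} {c = c} {w = w} {x = x} t≡3 x≤ fs q =
  true ∷ false ∷ c ,
  -- The root takes one of the five places in the first set and none in the second.
  node {w = 4 ◂ 5 ◂ w}
    (forest-++ {v = 1 ◂ (suc (size us) + x) ◂ w} (forest-true∷ (t ∷ []))
      -- `b` gets `true ∷ true ∷ 𝟎`: the first set reverses its edge to the root, the second its
      -- edges into `us`, whose vertices get `false ∷ true ∷ 𝟎`.
      (cons {v = 1 ◂ suc (size us) ◂ λ _ → 0} (cong (λ z → true xor (false xor z)) (dot-𝟎 c))
        (node {w = 0 ◂ size us ◂ λ _ → 0} (forest-false∷ true (forest-true∷ us))
          λ { zero → ≤-refl ; (suc zero) → ≤-refl
            ; (suc (suc i)) → ≤-reflexive (cong (λ x → bit x + 0) (lookup-replicate i false)) })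
        (forest-false∷ true fs)
        λ { zero → ≤-refl {1} ; (suc zero) → ≤-refl {suc (size us) + x} ; (suc (suc i)) → ≤-refl {w i} })
      λ { zero → ≤-reflexive (cong (_+ 1) t≡3)
        ; (suc zero) → ≤-trans (≤-reflexive (+-comm (suc (size us)) x)) x≤
        ; (suc (suc i)) → ≤-refl })
    λ { zero → ≤-refl ; (suc zero) → ≤-refl ; (suc (suc i)) → q i }

-- A connected piece of d edges can be cut off leaving a tree; its d + 1
-- vertices then form the extra set that recolours rest to t.
record Removable (d : ℕ) (t : Tree A) : Set where
  field
    rest   : Tree A
    count  : d + edgeCount rest ≡ edgeCount t
    extend : ∀ {k} {c : Vec Bool k} {u} → Coloring c u rest → ∃[ x ] Coloring (x ∷ c) (suc d ◂ u) t
open Removable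

removable-here : (ss : List (Tree A)) → size ss ≡ d → Removable d (node a (ss ++ ts))
removable-here {a = a} {ts = ts} ss s≡d = record
  { rest   = node a ts
  ; count  = sym (≡-trans (size-++ ss ts) (cong (_+ size ts) s≡d))
  ; extend = λ { f@(node _ _) → true , coloring-graft ss (≤-reflexive (cong suc s≡d)) f }
  }

removable-↭ : ts ↭ ss → Removable d (node a ts) → Removable d (node a ss)
removable-↭ π r = record
  { rest   = rest r
  ; count  = ≡-trans (count r) (size-↭ π)
  ; extend = λ f → let (x , g) = extend r f in x , coloring-↭ π g
  }

removable-there : ∀ {a : A} → Removable d t → Removable d (node a (t ∷ ts))
removable-there {d = d} {t = node b us} {ts = ts} {a} r with rest r | count r | extend r
... | node b′ us′ | eq | ext = record
  { rest   = node a (node b′ us′ ∷ ts)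
  ; count  = ≡-trans (+-suc d _) (cong suc (≡-trans (sym (+-assoc d _ _)) (cong (_+ size ts) eq)))
  ; extend = λ { (node {w = w} (cons {c = c} e f fs q) s) → let (x , g) = ext f in
      -- The root stays out of the new set, so the edge to the branch is unaffected by the bit `x`
      -- at its other end.
      false , node {w = suc d ◂ w}
        (cons e g (forest-false∷ false fs) λ { zero → ≤-reflexive (+-identityʳ (suc d)) ; (suc i) → q i })
        λ { zero → ≤-refl ; (suc i) → s i } }
  }

-- Descending into first branches ends at a leaf, and the edge above it is the piece.
removable-1 : ∀ t → 1 ≤ edgeCount {A} t → Removable 1 t
removable-1 (node a (node b [] ∷ ts))                  _ = removable-here (node b [] ∷ []) refl
removable-1 (node a (node b us@(node _ _ ∷ _) ∷ ts)) _ = removable-there (removable-1 (node b us) (s≤s z≤n))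

mutual
  -- The piece is two leaves with their common parent, or a branch of one edge together with the
  -- edge above it. Descending into branches that have an edge must meet one of the two.
  removable-2 : ∀ t → 2 ≤ edgeCount {A} t → Removable 2 t
  removable-2 (node a (node b us@(node _ _ ∷ _) ∷ ts))            _ = removable-2-branch (node b us) (s≤s z≤n)
  removable-2 (node a (node b [] ∷ []))                           (s≤s ())
  removable-2 (node a (node b [] ∷ node c [] ∷ ts))               _ = removable-here (node b [] ∷ node c [] ∷ []) refl
  removable-2 (node a (t@(node b []) ∷ s@(node c (node _ _ ∷ _)) ∷ ts)) _ =
    removable-↭ (swap s t refl) (removable-2-branch s (s≤s z≤n))

  removable-2-branch : ∀ {a : A} t → 1 ≤ edgeCount t → Removable 2 (node a (t ∷ ts))
  removable-2-branch t _ with edgeCount t in eq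
  ... | suc zero    = removable-here (t ∷ []) (≡-trans (size-∷ t []) (cong (λ x → suc (x + 0)) eq))
  ... | suc (suc _) = removable-there (removable-2 t (≤-trans (s≤s (s≤s z≤n)) (≤-reflexive (sym eq))))

-- Branches at a root

-- `edgeCount` leaves out the edge to the root, so `pair` means branches of 3 and of 2 or 3 edges,
-- and a `deep` branch has at least 5. The cases suffice: if branches of 1, 2 or 3 edges have at
-- least 4 edges altogether and no subfamily has exactly 4, then there is a 3, hence no 1, and a
-- second branch.
data Shape {A : Set} (ts : List (Tree A)) : Set where
  small : size ts ≤ 3 → Shape ts
  deep  : ∀ {b us rs} → ts ↭ node b us ∷ rs → 4 ≤ size us → Shape ts
  four  : ∀ ss {rs} → ts ↭ ss ++ rs → size ss ≡ 4 → Shape ts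
  pair  : ∀ {s t rs} → ts ↭ s ∷ t ∷ rs → edgeCount s ≡ 2 → edgeCount t ≡ 1 ⊎ edgeCount t ≡ 2 → Shape ts

shape-∷-small : (t : Tree A) (ts : List (Tree A)) → size ts ≤ 3 → Shape (t ∷ ts)
shape-∷-small t@(node _ us) ts s≤3 with size us in eq
... | suc (suc (suc (suc n))) = deep refl (≤-trans (m≤m+n 4 n) (≤-reflexive (sym eq)))
... | 3 = four (t ∷ []) refl (cong suc (≡-trans (+-identityʳ _) eq))
shape-∷-small t@(node _ us) [] s≤3 | 2 = small (≤-reflexive (cong suc (≡-trans (+-identityʳ _) eq)))
shape-∷-small t@(node _ us) (s@(node _ vs) ∷ ts) s≤3 | 2 with size vs in eq′
... | 0 = four (t ∷ s ∷ []) refl (cong₂ (λ x y → suc (x + suc (y + 0))) eq eq′)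
... | 1 = pair refl eq (inj₁ eq′)
... | 2 = pair refl eq (inj₂ eq′)
... | suc (suc (suc n)) = contradiction s≤3 λ { (s≤s (s≤s (s≤s ()))) }
shape-∷-small t@(node _ us) [] s≤3 | 1 = small (≤-trans (≤-reflexive (cong suc (≡-trans (+-identityʳ _) eq))) (n≤1+n 2))
shape-∷-small t@(node _ us) (s@(node _ vs) ∷ ts) s≤3 | 1 with size vs in eq′
... | 1 = four (t ∷ s ∷ []) refl (cong₂ (λ x y → suc (x + suc (y + 0))) eq eq′)
... | 2 = pair (swap t s refl) eq′ (inj₁ eq)
... | suc (suc (suc n)) = contradiction s≤3 λ { (s≤s (s≤s (s≤s ()))) }
... | 0 with ts
...   | [] = small (≤-reflexive (cong₂ (λ x y → suc (x + suc (y + 0))) eq eq′))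
...   | r@(node _ ws) ∷ rs with size ws in eq″
...     | 0 = four (t ∷ s ∷ r ∷ []) refl
                (≡-trans (cong₂ (λ x y → suc (x + suc (y + suc (size ws + 0)))) eq eq′) (cong (λ z → 4 + (z + 0)) eq″))
...     | 1 = four (t ∷ r ∷ []) (prep t (swap s r refl)) (cong₂ (λ x y → suc (x + suc (y + 0))) eq eq″)
...     | suc (suc n) = contradiction s≤3 λ { (s≤s (s≤s (s≤s ()))) }
shape-∷-small t@(node _ us) ts s≤3 | 0 with size ts in eq′
-- Here `t` is a single edge, so with all of `ts` it gives exactly four, however `ts` is divided.
... | 3 = four (t ∷ ts) (↭-reflexive (sym (++-identityʳ _))) (cong₂ (λ x y → suc (x + y)) eq eq′)
... | 0 = small (≤-trans (≤-reflexive (cong₂ (λ x y → suc (x + y)) eq eq′)) (m≤m+n 1 2))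
... | 1 = small (≤-trans (≤-reflexive (cong₂ (λ x y → suc (x + y)) eq eq′)) (m≤m+n 2 1))
... | 2 = small (≤-reflexive (cong₂ (λ x y → suc (x + y)) eq eq′))
... | suc (suc (suc (suc n))) = contradiction s≤3 λ { (s≤s (s≤s (s≤s ()))) }

-- `deep`, `four` and `pair` name some branches and leave the others in `rs`, so they survive an
-- additional branch; only `small` must be examined anew.
shape : (ts : List (Tree A)) → Shape ts
shape []       = small z≤n
shape (t ∷ ts) with shape ts
... | small s≤3        = shape-∷-small t ts s≤3
... | deep π 4≤        = deep (trans (prep t π) (swap t _ refl)) 4≤
... | four ss {rs} π e = four ss (trans (prep t π) (↭-sym (shift t ss rs))) e
... | pair π e e′      = pair (trans (prep t π) (trans (swap t _ refl) (prep _ (swap t _ refl)))) e e′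

-- The induction

-- The inequality says k ≤ ⌈2m/7⌉ for m edges.
Good : Tree A → Set
Good t = ∃[ k ] k * 7 ≤ 2 * edgeCount t + 6 × Solution k t

good-↭ : ts ↭ ss → Good (node a ts) → Good (node a ss)
good-↭ π (k , k≤ , c , f) = k , subst (λ m → k * 7 ≤ 2 * m + 6) (size-↭ π) k≤ , c , coloring-↭ π f

good-reroot : Good (node a (node b ts ∷ ss)) → Good (node b (node a ss ∷ ts))
good-reroot {ts = ts} {ss = ss} (k , k≤ , c , f) =
  k , subst (λ m → k * 7 ≤ 2 * suc m + 6) (+-comm (size ts) (size ss)) k≤ , coloring-reroot f

-- Four edges pay for one set, as 7 ≤ 2 * 4.
good-four : ∀ ss → size ss ≡ 4 → Good (node a ts) → Good (node a (ss ++ ts))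
good-four {ts = ts} ss s≡4 (k , k≤ , sol) = suc k , bound , solution-++ ss (≤-reflexive s≡4) sol
  where
  open ≤-Reasoning
  arith : ∀ m → 8 + (2 * m + 6) ≡ 2 * (4 + m) + 6
  arith = solve-∀
  bound : 7 + k * 7 ≤ 2 * size (ss ++ ts) + 6
  bound = begin
    7 + k * 7                 ≤⟨ +-mono-≤ (n≤1+n 7) k≤ ⟩
    8 + (2 * size ts + 6)     ≡⟨ arith (size ts) ⟩
    2 * (4 + size ts) + 6     ≡⟨ cong (λ x → 2 * (x + size ts) + 6) s≡4 ⟨
    2 * (size ss + size ts) + 6 ≡⟨ cong (λ x → 2 * x + 6) (size-++ ss ts) ⟨
    2 * size (ss ++ ts) + 6   ∎

good-small : ∀ (t : Tree A) → edgeCount t ≤ 3 → Good t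
good-small (node a [])                 _  = 0 , z≤n , [] , node {w = λ _ → 0} [] λ ()
good-small (node a ts@(node _ us ∷ ss)) ≤3 =
  -- The 6 from rounding up lets a single edge pay for a set: 7 ≤ 2 * 1 + 6.
  1 , +-monoˡ-≤ 6 (≤-trans (s≤s z≤n) (m≤m+n (suc (size us + size ss)) _)) ,
  subst (λ ts → Solution 1 (node a ts)) (++-identityʳ ts)
    (solution-++ ts (≤-trans ≤3 (n≤1+n 3)) ([] , node {w = λ _ → 0} [] λ ()))

-- Seven edges disappear: three for `s` with its edge to the root, and four for `t` with its edge
-- and the piece of `r`. They pay for two sets exactly, as 2 * 7 = 14. The piece lies inside the
-- branch `r`, so its set can avoid the root.
good-two-branches : ∀ {a : A} {s t r rs} (R : Removable d r) → edgeCount s ≡ 2 → suc (edgeCount t) + d ≡ 4 →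
  Good (node a (rest R ∷ rs)) → Good (node a (s ∷ t ∷ r ∷ rs))
good-two-branches {d = d} {s = s@(node _ _)} {t = node b us} {r = node b′ vs} {rs = rs} R s≡2 t+d≡4 G
  with rest R | count R | extend R | G
... | node _ vs′ | eq | ext | k , k≤ , c , node {w = w} (cons e f fs q) p =
  let (x , g) = ext f in
  2 + k , bound ,
  -- The piece has `suc d` vertices and the branch of `b` has `4 ∸ d`, which makes five.
  solution-two-branches {x = suc d} (cong suc (≡-trans (+-identityʳ _) s≡2)) (≤-reflexive (cong suc (≡-trans (+-comm d _) t+d≡4)))
    (cons e g (forest-false∷ false fs) λ { zero → ≤-reflexive (+-identityʳ (suc d)) ; (suc i) → q i }) p
  where
  open ≤-Reasoning
  arith : ∀ x d y z → 14 + (2 * (1 + (y + z)) + 6) + 2 * (1 + x + d) ≡ 2 * (1 + (2 + (1 + (x + (1 + ((d + y) + z)))))) + 6 + 8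
  arith = solve-∀
  bound : (2 + k) * 7 ≤ 2 * size (s ∷ node b us ∷ node b′ vs ∷ rs) + 6
  -- The 8 is twice the sum in `t+d≡4`; adding it to both sides avoids a subtraction.
  bound = +-cancelʳ-≤ 8 _ _ (begin
    14 + k * 7 + 8                                                ≤⟨ +-monoˡ-≤ 8 (+-monoʳ-≤ 14 k≤) ⟩
    14 + (2 * suc (size vs′ + size rs) + 6) + 8                   ≡⟨ cong (λ x → 14 + (2 * suc (size vs′ + size rs) + 6) + 2 * x) t+d≡4 ⟨
    14 + (2 * suc (size vs′ + size rs) + 6) + 2 * (suc (size us) + d) ≡⟨ arith (size us) d (size vs′) (size rs) ⟩
    2 * suc (2 + suc (size us + suc ((d + size vs′) + size rs))) + 6 + 8
      ≡⟨ cong₂ (λ x y → 2 * suc (x + suc (size us + suc (y + size rs))) + 6 + 8) (sym s≡2) eq ⟩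
    2 * size (s ∷ node b us ∷ node b′ vs ∷ rs) + 6 + 8 ∎)

-- No third branch is left to fill the second set, but the tree has at least 3 + 2 = 5 edges, for
-- which rounding up already allows two sets.
good-two-branches-only : ∀ {a : A} {s t} → edgeCount s ≡ 2 → 1 ≤ edgeCount t → edgeCount t ≤ 2 → Good (node a (s ∷ t ∷ []))
good-two-branches-only {s = s@(node _ ss)} {t = node b us} s≡2 1≤t t≤2 =
  2 , bound ,
  solution-two-branches {c = []} {w = λ _ → 0} {x = 0} (cong suc (≡-trans (+-identityʳ _) s≡2))
    (≤-trans (s≤s t≤2) (m≤m+n 3 2)) [] λ ()
  where
  open ≤-Reasoning
  bound : 14 ≤ 2 * size (s ∷ node b us ∷ []) + 6
  bound = begin
    14                                        ≤⟨ m≤m+n 14 2 ⟩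
    2 * suc (2 + suc (1 + 0)) + 6             ≤⟨ +-monoˡ-≤ 6 (*-monoʳ-≤ 2 (s≤s (+-monoʳ-≤ 2 (s≤s (+-monoˡ-≤ 0 1≤t))))) ⟩
    2 * suc (2 + suc (size us + 0)) + 6       ≡⟨ cong (λ x → 2 * suc (x + suc (size us + 0)) + 6) s≡2 ⟨
    2 * size (s ∷ node b us ∷ []) + 6         ∎

InductionHypothesis : Tree A → Set
InductionHypothesis {A} t = ∀ (s : Tree A) → edgeCount s < edgeCount t → Good s

good-pair : ∀ {a : A} s t rs → edgeCount s ≡ 2 → edgeCount t ≡ 1 ⊎ edgeCount t ≡ 2 →
  InductionHypothesis (node a (s ∷ t ∷ rs)) → Good (node a (s ∷ t ∷ rs))
good-pair s t [] s≡2 (inj₁ t≡1) ih = good-two-branches-only s≡2 (≤-reflexive (sym t≡1)) (≤-trans (≤-reflexive t≡1) (n≤1+n 1))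
good-pair s t [] s≡2 (inj₂ t≡2) ih = good-two-branches-only s≡2 (≤-trans (n≤1+n 1) (≤-reflexive (sym t≡2))) (≤-reflexive t≡2)
good-pair {a = a} s@(node _ ss) t@(node _ us) (r@(node _ vs) ∷ rs) s≡2 t≡ ih = go (edgeCount r) refl t≡
  where
  two : ∀ (x y : Tree _) {m n} → edgeCount x ≡ m → edgeCount y ≡ n → size (x ∷ y ∷ []) ≡ suc (m + suc (n + 0))
  two (node _ _) (node _ _) refl refl = refl

  drop-s : size (t ∷ r ∷ rs) < size (s ∷ t ∷ r ∷ rs)
  drop-s = s≤s (m≤n+m _ (size ss))

  drop-two : size (r ∷ rs) < size (s ∷ t ∷ r ∷ rs)
  drop-two = <-trans (s≤s (m≤n+m _ (size us))) drop-s

  drop-r : size (t ∷ rs) < size (s ∷ t ∷ r ∷ rs)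
  drop-r = ≤-<-trans (s≤s (+-monoʳ-≤ (size us) (m≤n⇒m≤1+n (m≤n+m (size rs) (size vs))))) drop-s

  drop-two-rest : size (s ∷ rs) < size (s ∷ t ∷ r ∷ rs)
  drop-two-rest = s≤s (+-monoʳ-< (size ss) (≤-<-trans (m≤n+m (size rs) (suc (size vs))) (s≤s (m≤n+m _ (size us)))))

  reduce : ∀ {d} (R : Removable d r) → suc (edgeCount t) + d ≡ 4 → Good (node a (s ∷ t ∷ r ∷ rs))
  reduce {d} R t+d≡4 = good-two-branches R s≡2 t+d≡4 (ih _ (≤-<-trans smaller drop-two))
    where
    smaller : size (rest R ∷ rs) ≤ size (r ∷ rs)
    smaller = ≤-trans (≤-reflexive (size-∷ (rest R) rs))
      (s≤s (+-monoˡ-≤ (size rs) (≤-trans (m≤n+m _ d) (≤-reflexive (count R)))))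

  -- Counting edges to the root: if `r` has one edge, it makes four with `s`; if `r` and `t` have
  -- two each, they make four. Otherwise `r` is large enough for a piece of one edge when `t` has
  -- three, and of two edges when `t` has two.
  go : ∀ n → edgeCount r ≡ n → edgeCount t ≡ 1 ⊎ edgeCount t ≡ 2 → Good (node a (s ∷ t ∷ r ∷ rs))
  go 0 r≡0 _ =
    good-↭ (prep s (swap r t refl)) (good-four (s ∷ r ∷ []) (two s r s≡2 r≡0) (ih _ drop-r))
  go 1 r≡1 (inj₁ t≡1) =
    good-↭ (shift s (t ∷ r ∷ []) rs) (good-four (t ∷ r ∷ []) (two t r t≡1 r≡1) (ih _ drop-two-rest))
  go (suc n) r≡ (inj₂ t≡2) = reduce (removable-1 r (≤-trans (s≤s z≤n) (≤-reflexive (sym r≡)))) (cong (λ x → suc x + 1) t≡2)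
  go (suc (suc n)) r≡ (inj₁ t≡1) =
    reduce (removable-2 r (≤-trans (s≤s (s≤s z≤n)) (≤-reflexive (sym r≡)))) (cong (λ x → suc x + 2) t≡1)

-- `ups` lies behind on the descent, `ds` ahead, and `m` bounds the remaining descent. The branches
-- of `four` and `pair` are chosen in `ds`; `ups` joins the remainder, where it can still serve as
-- the third branch in `good-pair`.
good-rooted : ∀ m (a : A) (ups ds : List (Tree A)) → size ds ≤ m → 4 ≤ size ds →
  InductionHypothesis (node a (ups ++ ds)) → Good (node a (ups ++ ds))
good-rooted m a ups ds ds≤m 4≤ ih with shape ds
... | small ≤3 = contradiction (≤-trans 4≤ ≤3) λ { (s≤s (s≤s (s≤s ()))) }
... | four ss {rs} π s≡4 = good-↭ (↭-sym ρ) (good-four ss s≡4 (ih (node a (ups ++ rs)) smaller))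
  where
  ρ : ups ++ ds ↭ ss ++ (ups ++ rs)
  ρ = trans (++⁺ˡ ups π) (shifts ups ss)
  smaller : size (ups ++ rs) < size (ups ++ ds)
  smaller = ≤-trans (+-monoˡ-≤ _ (≤-trans (s≤s z≤n) (≤-reflexive (sym s≡4))))
    (≤-reflexive (sym (≡-trans (size-↭ ρ) (size-++ ss (ups ++ rs)))))
... | pair {s} {t} {rs} π s≡2 t≡ = good-↭ (↭-sym ρ) (good-pair s t (ups ++ rs) s≡2 t≡
        λ x x< → ih x (≤-trans x< (≤-reflexive (sym (size-↭ ρ)))))
  where
  ρ : ups ++ ds ↭ s ∷ t ∷ (ups ++ rs)
  ρ = trans (++⁺ˡ ups π) (shifts ups (s ∷ t ∷ []))
good-rooted zero a ups ds ds≤m 4≤ ih | deep π 4≤us = contradiction (≤-trans 4≤ ds≤m) λ ()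
good-rooted (suc m) a ups ds ds≤m 4≤ ih | deep {b} {us} {rs} π 4≤us =
  -- The old root becomes the only branch behind `b`. The edge count is unchanged, so the induction
  -- hypothesis carries over.
  good-↭ (↭-sym ρ) (good-reroot (good-rooted m b (node a (ups ++ rs) ∷ []) us us≤m 4≤us
    λ x x< → ih x (≤-trans x< (≤-reflexive (≡-trans (cong suc (+-comm (size (ups ++ rs)) (size us))) (sym (size-↭ ρ)))))))
  where
  ρ : ups ++ ds ↭ node b us ∷ (ups ++ rs)
  ρ = trans (++⁺ˡ ups π) (shift (node b us) ups rs)
  us≤m : size us ≤ m
  us≤m = s≤s⁻¹ (≤-trans (≤-trans (s≤s (m≤m+n _ _)) (≤-reflexive (sym (size-↭ π)))) ds≤m)

good : (t : Tree A) → Good t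
good {A} t = <-rec (λ m → (t : Tree A) → edgeCount t ≡ m → Good t) step (edgeCount t) t refl
  where
  step : ∀ m → (∀ {n} → n < m → (t : Tree A) → edgeCount t ≡ n → Good t) → (t : Tree A) → edgeCount t ≡ m → Good t
  step _ ih t@(node a ts) refl with size ts ≤? 3
  ... | yes ≤3 = good-small t ≤3
  ... | no  ≰3 = good-rooted (size ts) a [] ts ≤-refl (≰⇒> ≰3) λ s s< → ih s< s refl

-- Spanning trees

labels : List (Tree A) → List A
labels []               = []
labels (node x us ∷ ts) = x ∷ labels us ++ labels ts

edges : A → List (Tree A) → List (A × A)
edges r []               = []
edges r (node x us ∷ ts) = (r , x) ∷ edges x us ++ edges r ts

length-labels : (ts : List (Tree A)) → length (labels ts) ≡ size ts
length-labels []               = refl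
length-labels (node x us ∷ ts) =
  cong suc (≡-trans (length-++ (labels us)) (cong₂ _+_ (length-labels us) (length-labels ts)))

-- The label `r` above the forest is quantified because it becomes `z` on entering the branch of
-- `z`.
insert-forest : ∀ (ts : List (Tree A)) {x} → x ∈ labels ts → ∀ y →
  ∃[ ts′ ] labels ts′ ↭ y ∷ labels ts × (∀ r → edges r ts′ ↭ (x , y) ∷ edges r ts)
insert-forest (node z us ∷ ts) (here refl) y =
  node z (node y [] ∷ us) ∷ ts , swap z y refl , λ r → swap (r , z) (z , y) refl
insert-forest (node z us ∷ ts) (there x∈) y with ∈-++⁻ (labels us) x∈
... | inj₁ x∈us = let (us′ , λ′ , ε′) = insert-forest us x∈us y in
  node z us′ ∷ ts ,
  trans (prep z (++⁺ʳ (labels ts) λ′)) (swap z y refl) ,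
  λ r → trans (prep (r , z) (++⁺ʳ (edges r ts) (ε′ z))) (swap (r , z) _ refl)
... | inj₂ x∈ts = let (ts′ , λ′ , ε′) = insert-forest ts x∈ts y in
  node z us ∷ ts′ ,
  trans (prep z (trans (++⁺ˡ (labels us) λ′) (shift y (labels us) (labels ts)))) (swap z y refl) ,
  λ r → trans (prep (r , z) (trans (++⁺ˡ (edges z us) (ε′ r)) (shift _ (edges z us) (edges r ts)))) (swap (r , z) _ refl)

insert : ∀ r (ts : List (Tree A)) {x} → x ∈ r ∷ labels ts → ∀ y →
  ∃[ ts′ ] labels ts′ ↭ y ∷ labels ts × edges r ts′ ↭ (x , y) ∷ edges r ts
insert r ts (here refl) y = node y [] ∷ ts , refl , refl
insert r ts (there x∈)  y = let (ts′ , λ′ , ε′) = insert-forest ts x∈ y in ts′ , λ′ , ε′ r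

Joined : List (A × A) → A → A → Set
Joined E u v = (u , v) ∈ E ⊎ (v , u) ∈ E

-- `unique` bounds the number of edges and gives each vertex one colour; `linked` supplies the walks
-- with which an edge outside the tree would close a cycle.
record Subtree (G : Graph n) (r : Fin n) (ts : List (Tree (Fin n))) : Set where
  field
    unique : Unique (r ∷ labels ts)
    sound  : ∀ {u v} → (u , v) ∈ edges r ts → adj G u v ≡ true
    linked : ∀ {u} → u ∈ r ∷ labels ts → Star (Joined (edges r ts)) r u
open Subtree

module _ (G : Graph n) (r : Fin n) where
  open DecMembership (_≟ᶠ_ {n}) using (_∈?_)

  subtree-insert : ∀ {ts x y} → Subtree G r ts → x ∈ r ∷ labels ts → adj G x y ≡ true → y ∉ r ∷ labels ts →
    ∃[ ts′ ] Subtree G r ts′ × r ∷ labels ts′ ↭ y ∷ r ∷ labels ts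
  subtree-insert {ts} {x} {y} S x∈ xy y∉ with insert r ts x∈ y
  ... | ts′ , λ′ , ε′ = ts′ , record { unique = unique′ ; sound = sound′ ; linked = linked′ } , ρ
    where
    ρ : r ∷ labels ts′ ↭ y ∷ r ∷ labels ts
    ρ = trans (prep r λ′) (swap r y refl)

    unique′ : Unique (r ∷ labels ts′)
    unique′ = Permutationₛ.Unique-resp-↭ (setoid (Fin n)) (↭⇒↭ₛ (↭-sym ρ)) (¬Any⇒All¬ _ y∉ ∷ unique S)

    sound′ : ∀ {u v} → (u , v) ∈ edges r ts′ → adj G u v ≡ true
    sound′ e with ∈-resp-↭ ε′ e
    ... | here refl = xy
    ... | there e′  = sound S e′

    old : ∀ {u v} → Joined (edges r ts) u v → Joined (edges r ts′) u v
    old (inj₁ e) = inj₁ (∈-resp-↭ (↭-sym ε′) (there e))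
    old (inj₂ e) = inj₂ (∈-resp-↭ (↭-sym ε′) (there e))

    linked′ : ∀ {u} → u ∈ r ∷ labels ts′ → Star (Joined (edges r ts′)) r u
    linked′ u∈ with ∈-resp-↭ ρ u∈
    ... | here refl = Star-map old (linked S x∈) ◅◅ inj₁ (∈-resp-↭ (↭-sym ε′) (here refl)) ◅ ε
    ... | there u∈′ = Star-map old (linked S u∈′)

  _⊑_ : (ts ts′ : List (Tree (Fin n))) → Set
  ts ⊑ ts′ = ∀ {z} → z ∈ r ∷ labels ts → z ∈ r ∷ labels ts′

  -- Along the walk, each vertex not yet covered is hung below its predecessor, which is covered by
  -- then.
  subtree-reach : ∀ {ts x y} → Subtree G r ts → x ∈ r ∷ labels ts → Star (λ u v → adj G u v ≡ true) x y →
    ∃[ ts′ ] Subtree G r ts′ × ts ⊑ ts′ × y ∈ r ∷ labels ts′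
  subtree-reach S x∈ ε = _ , S , (λ z∈ → z∈) , x∈
  subtree-reach {ts} S x∈ (_◅_ {j = w} xw ws) with w ∈? (r ∷ labels ts)
  ... | yes w∈ = subtree-reach S w∈ ws
  ... | no  w∉ with subtree-insert S x∈ xw w∉
  ...   | _ , S′ , ρ with subtree-reach S′ (∈-resp-↭ (↭-sym ρ) (here refl)) ws
  ...     | _ , S″ , ⊑″ , y∈ = _ , S″ , (λ z∈ → ⊑″ (∈-resp-↭ (↭-sym ρ) (there z∈))) , y∈

  subtree-cover : Connected G → ∀ xs → ∃[ ts ] Subtree G r ts × All (_∈ r ∷ labels ts) xs
  subtree-cover conn [] =
    [] , record { unique = [] ∷ [] ; sound = λ () ; linked = λ { (here refl) → ε } } , []
  subtree-cover conn (x ∷ xs) with subtree-cover conn xs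
  ... | _ , S , xs∈ with subtree-reach S (here refl) (conn r x)
  ...   | _ , S′ , ⊑′ , x∈ = _ , S′ , x∈ ∷ All.map ⊑′ xs∈

-- Loop erasure

data Path {A : Set} (R : A → A → Set) : A → A → List A → Set where
  [_] : ∀ u → Path R u u (u ∷ [])
  _∷_ : ∀ {u v w xs} → R u w → Path R w v xs → Path R u v (u ∷ xs)

path-from : ∀ {R : A → A → Set} {u v w xs} → u ∈ xs → Path R w v xs → Unique xs → ∃[ ys ] Path R u v ys × Unique ys
path-from (here refl) [ u ]    uq       = _ , [ u ] , uq
path-from (here refl) (e ∷ p)  uq       = _ , e ∷ p , uq
path-from (there u∈)  (_ ∷ p)  (_ ∷ uq) = path-from u∈ p uq

-- If `u` recurs on the simple path from its successor, only the part from that recurrence on is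
-- kept.
simple-path : ∀ {R : Fin n → Fin n → Set} {u v} → Star R u v → ∃[ xs ] Path R u v xs × Unique xs
simple-path {u = u} ε = _ , [ u ] , [] ∷ []
simple-path {n = n} {u = u} (e ◅ es) with simple-path es
... | xs , p , uq with u ∈? xs
  where open DecMembership (_≟ᶠ_ {n}) using (_∈?_)
...   | yes u∈ = path-from u∈ p uq
...   | no  u∉ = _ , e ∷ p , ¬Any⇒All¬ _ u∉ ∷ uq

path-isWalk : ∀ (G : Graph n) {R : Fin n → Fin n → Set} → (∀ {u v} → R u v → adj G u v ≡ true) →
  ∀ {u v xs z} → Path R u v xs → adj G v z ≡ true → IsWalk G (xs ++ z ∷ [])
path-isWalk G R⇒adj [ u ]             vz = vz , tt
path-isWalk G R⇒adj (e ∷ p@([ _ ]))   vz = R⇒adj e , path-isWalk G R⇒adj p vz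
path-isWalk G R⇒adj (e ∷ p@(_ ∷ _))   vz = R⇒adj e , path-isWalk G R⇒adj p vz

path-nonempty : ∀ {R : A → A → Set} {u v xs} → Path R u v xs → 1 ≤ length xs
path-nonempty [ _ ]   = s≤s z≤n
path-nonempty (_ ∷ _) = s≤s z≤n

-- The loop-erased tree path from `u` to `v` is not trivial, because `adj G` is irreflexive. A
-- single step is a tree edge; with two or more steps, the edge from `v` back to `u` would close a
-- cycle.
edge⇒joined : ∀ (G : Graph n) {r ts} → Acyclic G → Subtree G r ts → (∀ u → u ∈ r ∷ labels ts) →
  ∀ {u v} → adj G u v ≡ true → Joined (edges r ts) u v
edge⇒joined G {r} {ts} acyclic S all∈ {u} {v} uv =
  close (simple-path (Star-reverse Sum.swap (linked S (all∈ u)) ◅◅ linked S (all∈ v)))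
  where
  joined⇒adj : ∀ {u v} → Joined (edges r ts) u v → adj G u v ≡ true
  joined⇒adj (inj₁ e) = sound S e
  joined⇒adj (inj₂ e) = ≡-trans (adj-sym G _ _) (sound S e)

  close : ∃[ xs ] Path (Joined (edges r ts)) u v xs × Unique xs → Joined (edges r ts) u v
  close (_ , [ _ ] , _)               = contradiction (≡-trans (sym uv) (irrefl G u)) λ ()
  close (_ , e ∷ [ _ ] , _)           = e
  close (_ , p@(_ ∷ (_ ∷ q)) , uq) = ⊥-elim (acyclic _
    (s≤s (s≤s (path-nonempty q)) , uq , path-isWalk G joined⇒adj p (≡-trans (adj-sym G v u) uv)))

-- Counting distinct vertices

lookup-unique : ∀ {xs : List A} → Unique xs → ∀ {i j} → List.lookup xs i ≡ List.lookup xs j → i ≡ j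
lookup-unique (_ ∷ uq)  {zero}  {zero}  _  = refl
lookup-unique (x∉ ∷ uq) {zero}  {suc j} eq = contradiction eq (All.lookup x∉ (∈-lookup j))
lookup-unique (x∉ ∷ uq) {suc i} {zero}  eq = contradiction (sym eq) (All.lookup x∉ (∈-lookup i))
lookup-unique (_ ∷ uq)  {suc i} {suc j} eq = cong suc (lookup-unique uq eq)

unique-length : ∀ {xs : List (Fin n)} → Unique xs → length xs ≤ n
unique-length uq = injective⇒≤ (lookup-unique uq)

-- From colourings to inversions

vertexColors : ∀ {p : Vec Bool k} {u ts} → ForestColoring {A} p u ts → List (A × Vec Bool k)
vertexColors []                                             = []
vertexColors (cons {c = c} _ (node {a = x} fs _) gs _) = (x , c) ∷ vertexColors fs ++ vertexColors gs

map-proj₁-vertexColors : ∀ {p : Vec Bool k} {u ts} (fs : ForestColoring {A} p u ts) → map proj₁ (vertexColors fs) ≡ labels ts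
map-proj₁-vertexColors []                        = refl
map-proj₁-vertexColors (cons _ (node {a = x} fs _) gs _) =
  cong (x ∷_) (≡-trans (map-++ proj₁ (vertexColors fs) _) (cong₂ _++_ (map-proj₁-vertexColors fs) (map-proj₁-vertexColors gs)))

weight : Fin k → List (A × Vec Bool k) → ℕ
weight i []            = 0
weight i ((_ , c) ∷ l) = bit (lookup c i) + weight i l

weight-++ : ∀ i (l m : List (A × Vec Bool k)) → weight i (l ++ m) ≡ weight i l + weight i m
weight-++ i []            m = refl
weight-++ i ((_ , c) ∷ l) m =
  ≡-trans (cong (bit (lookup c i) +_) (weight-++ i l m)) (sym (+-assoc (bit (lookup c i)) _ _))

weight-vertexColors : ∀ {p : Vec Bool k} {u ts} (fs : ForestColoring {A} p u ts) i → weight i (vertexColors fs) ≤ u i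
weight-vertexColors []                                                         i = z≤n
weight-vertexColors {u = u} (cons {c = c} {v = v} {w = w} _ (node {w = x} fs q) gs r) i = begin
  bit (lookup c i) + weight i (vertexColors fs ++ vertexColors gs)
    ≡⟨ cong (bit (lookup c i) +_) (weight-++ i (vertexColors fs) _) ⟩
  bit (lookup c i) + (weight i (vertexColors fs) + weight i (vertexColors gs))
    ≤⟨ +-monoʳ-≤ (bit (lookup c i)) (+-mono-≤ (weight-vertexColors fs i) (weight-vertexColors gs i)) ⟩
  bit (lookup c i) + (x i + w i)
    ≡⟨ +-assoc (bit (lookup c i)) (x i) (w i) ⟨
  bit (lookup c i) + x i + w i
    ≤⟨ +-monoˡ-≤ (w i) (q i) ⟩
  v i + w i
    ≤⟨ r i ⟩
  u i ∎
  where open ≤-Reasoning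

EndColors : List (A × Vec Bool k) → A → A → Set
EndColors l x y = ∃[ c ] ∃[ d ] (x , c) ∈ l × (y , d) ∈ l × dot c d ≡ true

endColors-⊆ : ∀ {l m : List (A × Vec Bool k)} {x y} → (∀ {z} → z ∈ l → z ∈ m) → EndColors l x y → EndColors m x y
endColors-⊆ l⊆m (c , d , c∈ , d∈ , e) = c , d , l⊆m c∈ , l⊆m d∈ , e

edge-endColors : ∀ {p : Vec Bool k} {u r x y ts} (fs : ForestColoring {A} p u ts) →
  (x , y) ∈ edges r ts → EndColors ((r , p) ∷ vertexColors fs) x y
edge-endColors (cons e (node fs _) gs _) (here refl) = _ , _ , here refl , there (here refl) , e
edge-endColors {ts = node z us ∷ ts} (cons e (node fs _) gs _) (there xy) with ∈-++⁻ (edges z us) xy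
... | inj₁ xy∈ = endColors-⊆ (λ { (here z≡) → there (here z≡) ; (there z∈) → there (there (∈-++⁺ˡ z∈)) }) (edge-endColors fs xy∈)
... | inj₂ xy∈ = endColors-⊆ (λ { (here z≡) → here z≡ ; (there z∈) → there (there (∈-++⁺ʳ (vertexColors fs) z∈)) }) (edge-endColors gs xy∈)

class : Fin k → List (Fin n × Vec Bool k) → Subset n
class i []            = ⊥
class i ((x , c) ∷ l) = if lookup c i then class i l [ x ]≔ inside else class i l

∣update∣≤ : ∀ (X : Subset n) x → ∣ X [ x ]≔ inside ∣ ≤ suc ∣ X ∣
∣update∣≤ (true  ∷ X) zero    = n≤1+n _
∣update∣≤ (false ∷ X) zero    = ≤-refl
∣update∣≤ (true  ∷ X) (suc x) = s≤s (∣update∣≤ X x)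
∣update∣≤ (false ∷ X) (suc x) = ∣update∣≤ X x

-- The weight counts a vertex once per entry, the class only once.
∣class∣≤weight : ∀ (i : Fin k) (l : List (Fin n × Vec Bool k)) → ∣ class i l ∣ ≤ weight i l
∣class∣≤weight {n = n} i []  = ≤-reflexive (∣⊥∣≡0 n)
∣class∣≤weight i ((x , c) ∷ l) with lookup c i
... | true  = ≤-trans (∣update∣≤ (class i l) x) (s≤s (∣class∣≤weight i l))
... | false = ∣class∣≤weight i l

lookup-class-∉ : ∀ (i : Fin k) (l : List (Fin n × Vec Bool k)) {x} → x ∉ map proj₁ l → lookup (class i l) x ≡ false
lookup-class-∉ i [] {x} x∉ = lookup-replicate x false
lookup-class-∉ i ((y , c) ∷ l) x∉ with lookup c i
... | true  = ≡-trans (lookup∘update′ (λ x≡y → x∉ (here x≡y)) (class i l) inside) (lookup-class-∉ i l (λ x∈ → x∉ (there x∈)))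
... | false = lookup-class-∉ i l (λ x∈ → x∉ (there x∈))

-- Since the keys are distinct, no other entry can put `x` into the class.
lookup-class : ∀ (i : Fin k) {l : List (Fin n × Vec Bool k)} {x c} → Unique (map proj₁ l) → (x , c) ∈ l →
  lookup (class i l) x ≡ lookup c i
lookup-class i {(x , c) ∷ l} (x≢ ∷ uq) (here refl) with lookup c i
... | true  = lookup∘update x (class i l) inside
... | false = lookup-class-∉ i l λ x∈ → All.lookup x≢ x∈ refl
lookup-class i {(y , d) ∷ l} (y≢ ∷ uq) (there xc∈) with lookup d i
... | true  = ≡-trans (lookup∘update′ (λ x≡y → All.lookup y≢ (∈-map⁺ proj₁ xc∈) (sym x≡y)) (class i l) inside) (lookup-class i uq xc∈)
... | false = lookup-class i uq xc∈

-- Inversions modulo two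

parity : List (Subset n) → Fin n → Fin n → Bool
parity []       u v = false
parity (X ∷ Xs) u v = (lookup X u ∧ lookup X v) xor parity Xs u v

parity-comm : ∀ (Xs : List (Subset n)) u v → parity Xs u v ≡ parity Xs v u
parity-comm []       u v = refl
parity-comm (X ∷ Xs) u v = cong₂ _xor_ (∧-comm (lookup X u) (lookup X v)) (parity-comm Xs u v)

-- The sets containing both ends are the common bits of the two colours, so their parity is the
-- inner product.
parity-tabulate : ∀ (c d : Vec Bool k) (X : Fin k → Subset n) {u v} →
  (∀ i → lookup (X i) u ≡ lookup c i) → (∀ i → lookup (X i) v ≡ lookup d i) → parity (tabulate X) u v ≡ dot c d
parity-tabulate []      []      X p q = refl
parity-tabulate (_ ∷ c) (_ ∷ d) X p q =
  cong₂ _xor_ (cong₂ _∧_ (p zero) (q zero)) (parity-tabulate c d (λ i → X (suc i)) (λ i → p (suc i)) (λ i → q (suc i)))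

-- Each inversion exchanges the values at `u v` and `v u` or keeps both, so only the parity of the
-- exchanges matters.
invertAll-parity : ∀ (Xs : List (Subset n)) D u v → invertAll Xs D u v ≡ (if parity Xs u v then D v u else D u v)
invertAll-parity []       D u v = refl
invertAll-parity (X ∷ Xs) D u v rewrite invertAll-parity Xs (invert X D) u v | ∧-comm (lookup X v) (lookup X u)
  with lookup X u ∧ lookup X v | parity Xs u v
... | true  | true  = refl
... | true  | false = refl
... | false | true  = refl
... | false | false = refl

-- Off the edges of `G` the parity may be anything: `D` is `false` both ways there, so an exchange
-- changes nothing.
converse-by-parity : ∀ (G : Graph n) {D} → IsOrientation G D → ∀ Xs →
  (∀ u v → adj G u v ≡ true → parity Xs u v ≡ true) → ∀ u v → invertAll Xs D u v ≡ converse D u v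
converse-by-parity G {D} O Xs odd u v = ≡-trans (invertAll-parity Xs D u v) (cases (adj G u v) refl)
  where
  open IsOrientation O
  no-arc : ∀ u v → adj G u v ≡ false → D u v ≡ false
  no-arc u v ¬uv with D u v in eq
  ... | false = refl
  ... | true  = contradiction (≡-trans (sym (arc⇒edge u v eq)) ¬uv) λ ()

  cases : ∀ x → adj G u v ≡ x → (if parity Xs u v then D v u else D u v) ≡ D v u
  cases true  uv  rewrite odd u v uv = refl
  cases false ¬uv rewrite no-arc u v ¬uv | no-arc v u (≡-trans (adj-sym G v u) ¬uv) with parity Xs u v
  ... | true  = refl
  ... | false = refl

theorem26 : (n : ℕ) (T : Graph n) → IsTree T → conv≤ 5 T (((2 * n ∸ 2) + 6) / 7)
theorem26 zero    T _                D O = [] , z≤n , [] , λ ()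
theorem26 (suc n) T (conn , acyclic) D O with subtree-cover T zero conn (allFin (suc n))
... | ts , S , all∈ with good (node zero ts)
...   | k , k≤ , c , node fs bound =
  tabulate X , length≤ , tabulate⁺ X≤5 , converse-by-parity T O (tabulate X) odd
  where
  l : List (Fin (suc n) × Vec Bool k)
  l = (zero , c) ∷ vertexColors fs

  X : Fin k → Subset (suc n)
  X i = class i l

  X≤5 : ∀ i → ∣ X i ∣ ≤ 5
  X≤5 i = ≤-trans (∣class∣≤weight i l) (≤-trans (+-monoʳ-≤ (bit (lookup c i)) (weight-vertexColors fs i)) (bound i))

  size≤ : size ts ≤ n
  size≤ = s≤s⁻¹ (≤-trans (≤-reflexive (cong suc (sym (length-labels ts)))) (unique-length (unique S)))

  -- Adding 6 before dividing by 7 rounds up, and distinctness of the `suc n` possible labels leaves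
  -- at most `n` edges.
  length≤ : length (tabulate X) ≤ ((2 * suc n ∸ 2) + 6) / 7
  length≤ = begin
    length (tabulate X)          ≡⟨ length-tabulate X ⟩
    k                            ≡⟨ m*n/n≡m k 7 ⟨
    k * 7 / 7                    ≤⟨ /-monoˡ-≤ 7 k≤ ⟩
    (2 * size ts + 6) / 7        ≤⟨ /-monoˡ-≤ 7 (+-monoˡ-≤ 6 (*-monoʳ-≤ 2 size≤)) ⟩
    (2 * n + 6) / 7              ≡⟨ cong (λ x → (x ∸ 2 + 6) / 7) (*-suc 2 n) ⟨
    ((2 * suc n ∸ 2) + 6) / 7    ∎
    where open ≤-Reasoning

  keys-unique : Unique (map proj₁ l)
  keys-unique = subst (λ ks → Unique (zero ∷ ks)) (sym (map-proj₁-vertexColors fs)) (unique S)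

  odd-edge : ∀ {u v} → (u , v) ∈ edges zero ts → parity (tabulate X) u v ≡ true
  odd-edge e with edge-endColors fs e
  ... | p , q , p∈ , q∈ , pq =
    ≡-trans (parity-tabulate p q X (λ i → lookup-class i keys-unique p∈) (λ i → lookup-class i keys-unique q∈)) pq

  odd : ∀ u v → adj T u v ≡ true → parity (tabulate X) u v ≡ true
  odd u v uv with edge⇒joined T acyclic S (λ x → All.lookup all∈ (∈-allFin x)) uv
  ... | inj₁ e = odd-edge e
  ... | inj₂ e = ≡-trans (parity-comm (tabulate X) u v) (odd-edge e)
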